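{- Let $(a_n,b_n)$, $n\ge1$, be the $P$-positions $(x,y)$ with $0<x\le y$ of Corner the 2-Queen Dee, listed so that $a_1<a_2<\cdots$. Then for every $n\ge1$, $$a_{b_n}=a_n+b_n\quad\text{or}\quad a_{b_n}=a_n+b_n-1.$$
   Context: Positions are pairs $(x,y)$ of nonnegative integers. From $(x,y)$ the 2-Queen Dee may move to any position different from $(x,y)$ among: (i) $(x',y)$ with $0\le x'<x$, or $(x,y')$ with $0\le y'<y$; (ii) for each starting point $(u,v)\in\{(x,y),(x-1,y),(x,y-1)\}$ with $u,v\ge0$: the positions $(u-s,v-s)$ with $0\le s\le\min(u,v)$, and, if $u<v$, the positions $(t,v-u-t)$ with $0<t\le v-u$, and, if $u>v$, the positions $(u-v-t,t)$ with $0<t\le u-v$. Every move strictly decreases $x+y$. $P$-positions: $(0,0)$ is a $P$-position, and a position is a $P$-position iff it has no move to a $P$-position. -}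

module Defs where

open import Data.Nat using (ℕ; zero; suc; _+_; _∸_; _⊓_; _<ᵇ_; _<_; _≤_)
open import Data.Bool using (Bool; true; false; not; if_then_else_; T)
open import Data.List using (List; []; _∷_; _++_; map; concatMap; upTo; filterᵇ)
open import Data.Bool.ListAction using (any)
open import Data.Product using (_×_; _,_; proj₁; proj₂; Σ; ∃)
open import Relation.Binary.PropositionalEquality using (_≡_)

Pos : Set
Pos = ℕ × ℕ

rookMoves : ℕ → ℕ → List Pos
rookMoves x y = map (λ x' → (x' , y)) (upTo x) ++ map (λ y' → (x , y')) (upTo y)

starts : ℕ → ℕ → List Pos
starts x y = (x , y) ∷ (left x y ++ down x y)
  where
  left : ℕ → ℕ → List Pos
  left zero    y = []
  left (suc x) y = (x , y) ∷ []
  down : ℕ → ℕ → List Pos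
  down x zero    = []
  down x (suc y) = (x , y) ∷ []

fromStart : Pos → List Pos
fromStart (u , v) =
  map (λ s → (u ∸ s , v ∸ s)) (upTo (suc (u ⊓ v))) ++
  (if u <ᵇ v then map (λ t → (t , (v ∸ u) ∸ t)) (map suc (upTo (v ∸ u)))
   else if v <ᵇ u then map (λ t → ((u ∸ v) ∸ t , t)) (map suc (upTo (u ∸ v)))
   else [])

-- All moves from (x,y).  We keep only targets with strictly smaller x+y
-- (this excludes (x,y) itself).
moves : ℕ → ℕ → List Pos
moves x y = filterᵇ (λ p → (proj₁ p + proj₂ p) <ᵇ (x + y))
                    (rookMoves x y ++ concatMap fromStart (starts x y))

-- P-status computed with fuel; with fuel ≥ x+y the fuel never runs out
-- on a position with a move (each move decreases x+y by at least 1).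
pAux : ℕ → ℕ → ℕ → Bool
pAux zero    x y = true
pAux (suc k) x y = not (any (λ p → pAux k (proj₁ p) (proj₂ p)) (moves x y))

isPᵇ : ℕ → ℕ → Bool
isPᵇ x y = pAux (x + y) x y

IsP : ℕ → ℕ → Set
IsP x y = T (isPᵇ x y)

-- (a n, b n), n ≥ 1, is the list of P-positions (x,y) with 0 < x ≤ y,
-- ordered so that a 1 < a 2 < ⋯  (values at index 0 are irrelevant)
IsListing : (ℕ → ℕ) → (ℕ → ℕ) → Set
IsListing a b =
  (∀ n → 1 ≤ n → a n < a (suc n)) ×
  (∀ n → 1 ≤ n → IsP (a n) (b n) × 0 < a n × a n ≤ b n) ×
  (∀ x y → IsP x y → 0 < x → x ≤ y → Σ ℕ λ n → 1 ≤ n × a n ≡ x × b n ≡ y)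

{-# OPTIONS --safe #-}
module Submission where

open import Defs
open import Data.Bool using (true; false; if_then_else_; T; T?)
open import Data.Bool.ListAction using (any)
open import Data.Empty using (⊥-elim)
open import Data.List
  using (List; []; _∷_; [_]; _++_; length; concatMap; map; take; drop; upTo; deduplicate)
open import Data.List.Membership.Propositional using (_∈_; find; lose)
open import Data.List.Membership.Propositional.Properties
open import Data.List.Properties as List
  using (++-assoc; ++-identityʳ; ++-cancelˡ; length-++; concatMap-++; take++drop≡id)
open import Data.List.Relation.Unary.All as All using (All; all?)
open import Data.List.Relation.Unary.Any as Any using (here; there)
open import Data.List.Relation.Unary.Any.Properties using (any⁺; any⁻; concatMap⁺; concatMap⁻)
open import Data.Nat
  using (ℕ; zero; suc; _+_; _*_; _∸_; _⊓_; _≤_; _<_; _<ᵇ_; z≤n; s≤s; _≟_; _≤?_)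
open import Data.Nat.Induction using (<-rec)
open import Data.Nat.Properties
open import Data.Nat.Tactic.RingSolver using (solve-∀)
open import Data.Product using (Σ; ∃; _×_; _,_; proj₁; proj₂)
open import Data.Product.Properties as Product using ()
open import Data.Sum using (_⊎_; inj₁; inj₂)
open import Data.Unit using (⊤; tt)
open import Relation.Binary.Definitions using (DecidableEquality; tri<; tri≈; tri>)
open import Relation.Binary.PropositionalEquality
  using (_≡_; _≢_; refl; sym; trans; cong; cong₂; subst; subst₂; module ≡-Reasoning)
open import Relation.Nullary using (¬_; Dec; yes; no)
open import Relation.Nullary.Decidable using (_×-dec_; _⊎-dec_; from-yes)

-- Let t be the Tribonacci word, the fixed point of φ : 0 ↦ 01, 1 ↦ 02, 2 ↦ 0, and count letters
-- in its prefix of length n - 1.  Then aₙ = n + #1, eₙ = n + #0, fₙ = aₙ + eₙ and bₙ = aₙ + 2 eₙ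
-- describe the game: t = φ(t) makes {eₙ}, {fₙ} complementary, and t = φ²(t) makes {aₙ}, {bₙ}
-- complementary.  The diagonal and antidiagonal moves forbid the differences bₙ - aₙ = 2 eₙ and
-- the sums aₙ + bₙ = 2 fₙ up to ±1, so complementarity shows that (0,0), (aₙ,bₙ), (bₙ,aₙ) form
-- the kernel of the move graph.  Finally a at index bₙ is bₙ plus the number of 1s in the prefix of
-- length bₙ - 1, which is compared with the prefix of length n - 1 by a finite automaton: both
-- prefixes are desubstituted by φ simultaneously, and only 29 relative configurations occur.
--
-- Indices are shifted by one in the proof: A n, B n, E n, F n are a, b, e, f at n + 1.

-- The Tribonacci word

data Letter : Set where
  l0 l1 l2 : Letter

Word : Set
Word = List Letter

φ : Letter → Word
φ l0 = l0 ∷ l1 ∷ []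
φ l1 = l0 ∷ l2 ∷ []
φ l2 = l0 ∷ []

φ* : Word → Word
φ* = concatMap φ

-- queue n is the word w with φ(t₀…tₙ) = t₀…tₙ w; its first letter is tₙ₊₁.
pop : Word → Word
pop []      = []
pop (x ∷ w) = w ++ φ x

queue : ℕ → Word
queue zero    = [ l1 ]
queue (suc n) = pop (queue n)

front : Word → Letter
front []      = l0
front (x ∷ _) = x

t : ℕ → Letter
t zero    = l0
t (suc n) = front (queue n)

pre : ℕ → Word
pre zero    = []
pre (suc n) = pre n ++ [ t n ]

length-pre : ∀ n → length (pre n) ≡ n
length-pre zero    = refl
length-pre (suc n) = begin
  length (pre n ++ [ t n ]) ≡⟨ length-++ (pre n) ⟩
  length (pre n) + 1        ≡⟨ +-comm (length (pre n)) 1 ⟩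
  suc (length (pre n))      ≡⟨ cong suc (length-pre n) ⟩
  suc n                     ∎
  where open ≡-Reasoning

At : ℕ → Word → Set
At n []      = ⊤
At n (x ∷ w) = t n ≡ x × At (suc n) w

factor : ℕ → ℕ → Word
factor n zero    = []
factor n (suc k) = t n ∷ factor (suc n) k

At-factor : ∀ n k → At n (factor n k)
At-factor n zero    = tt
At-factor n (suc k) = refl , At-factor (suc n) k

pre-+ : ∀ n k → pre (n + k) ≡ pre n ++ factor n k
pre-+ n zero    = trans (cong pre (+-identityʳ n)) (sym (++-identityʳ (pre n)))
pre-+ n (suc k) = begin
  pre (n + suc k)                       ≡⟨ cong pre (+-suc n k) ⟩
  pre (suc n + k)                       ≡⟨ pre-+ (suc n) k ⟩
  (pre n ++ [ t n ]) ++ factor (suc n) k ≡⟨ ++-assoc (pre n) [ t n ] _ ⟩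
  pre n ++ factor n (suc k)             ∎
  where open ≡-Reasoning

At⇒factor : ∀ n w → At n w → w ≡ factor n (length w)
At⇒factor n []      _        = refl
At⇒factor n (x ∷ w) (e , at) = cong₂ _∷_ (sym e) (At⇒factor (suc n) w at)

pre-At : ∀ n w → At n w → pre (n + length w) ≡ pre n ++ w
pre-At n w at = trans (pre-+ n (length w)) (cong (pre n ++_) (sym (At⇒factor n w at)))

At-pre : ∀ n w → pre (n + length w) ≡ pre n ++ w → At n w
At-pre n w eq = subst (At n) factor≡w (At-factor n (length w))
  where
  factor≡w : factor n (length w) ≡ w
  factor≡w = ++-cancelˡ (pre n) _ _ (trans (sym (pre-+ n (length w))) eq)

At-++ˡ : ∀ n u v → At n (u ++ v) → At n u
At-++ˡ n []      v _        = tt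
At-++ˡ n (x ∷ u) v (e , at) = e , At-++ˡ (suc n) u v at

At-++ʳ : ∀ n u v → At n (u ++ v) → At (n + length u) v
At-++ʳ n []      v at       = subst (λ k → At k v) (sym (+-identityʳ n)) at
At-++ʳ n (x ∷ u) v (_ , at) =
  subst (λ k → At k v) (sym (+-suc n (length u))) (At-++ʳ (suc n) u v at)

At-++ : ∀ n u v → At n u → At (n + length u) v → At n (u ++ v)
At-++ n []      v _         at = subst (λ k → At k v) (+-identityʳ n) at
At-++ n (x ∷ u) v (e , at₁) at =
  e , At-++ (suc n) u v at₁ (subst (λ k → At k v) (+-suc n (length u)) at)

NonEmpty : Word → Set
NonEmpty w = ∃ λ x → ∃ λ v → w ≡ x ∷ v

-- Each `pop` removes one letter and appends the nonempty word `φ x`, so the queue never runs out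
-- and `front` always reads a genuine letter.
queue-nonEmpty : ∀ n → NonEmpty (queue n)
queue-nonEmpty zero    = l1 , [] , refl
queue-nonEmpty (suc n) with queue n | queue-nonEmpty n
... | x ∷ y ∷ v | _ = y , v ++ φ x , refl
... | l0 ∷ []   | _ = l0 , [ l1 ] , refl
... | l1 ∷ []   | _ = l0 , [ l2 ] , refl
... | l2 ∷ []   | _ = l0 , [] , refl
... | []        | _ , _ , ()

-- The queue is first-in first-out: whatever already stands in it is emitted in order as the next
-- letters of `t`.
queue-At : ∀ n u v → queue n ≡ u ++ v → At (suc n) u
queue-At n []      v _  = tt
queue-At n (x ∷ u) v eq = cong front eq , queue-At (suc n) u (v ++ φ x)
  (trans (cong pop eq) (++-assoc u v (φ x)))

φ*-[] : ∀ x → φ* [ x ] ≡ φ x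
φ*-[] x = ++-identityʳ (φ x)

φ*-pre-suc : ∀ n → φ* (pre (suc n)) ≡ φ* (pre n) ++ φ (t n)
φ*-pre-suc n = trans (concatMap-++ φ (pre n) [ t n ]) (cong (φ* (pre n) ++_) (φ*-[] (t n)))

-- The queue invariant. Moving the front letter `x` into the prefix appends `φ x` to the image,
-- which is exactly what `pop` appends to the queue.
φ*-pre : ∀ n → φ* (pre (suc n)) ≡ pre (suc n) ++ queue n
φ*-pre zero    = refl
φ*-pre (suc n) with queue n | queue-nonEmpty n | φ*-pre n | φ*-pre-suc (suc n)
... | .(x ∷ v) | x , v , refl | ih | step = begin
  φ* (pre (suc n) ++ [ x ])          ≡⟨ step ⟩
  φ* (pre (suc n)) ++ φ x            ≡⟨ cong (_++ φ x) ih ⟩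
  (pre (suc n) ++ x ∷ v) ++ φ x      ≡⟨ ++-assoc (pre (suc n)) (x ∷ v) (φ x) ⟩
  pre (suc n) ++ x ∷ (v ++ φ x)      ≡⟨ ++-assoc (pre (suc n)) [ x ] (v ++ φ x) ⟨
  (pre (suc n) ++ [ x ]) ++ v ++ φ x ∎
  where open ≡-Reasoning

-- Desubstitution: locating positions inside images of letters

-- The position in `t` = φ(`t`) at which the image of the letter `t n` begins.
scale : ℕ → ℕ
scale n = length (φ* (pre n))

pre-scale : ∀ n → pre (scale n) ≡ φ* (pre n)
pre-scale zero    = refl
pre-scale (suc n) = begin
  pre (scale (suc n))                          ≡⟨ cong (λ w → pre (length w)) (φ*-pre n) ⟩
  pre (length (pre (suc n) ++ queue n))        ≡⟨ cong pre (length-++ (pre (suc n))) ⟩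
  pre (length (pre (suc n)) + length (queue n)) ≡⟨ cong (λ k → pre (k + length (queue n))) (length-pre (suc n)) ⟩
  pre (suc n + length (queue n))               ≡⟨ pre-At (suc n) (queue n) at-queue ⟩
  pre (suc n) ++ queue n                       ≡⟨ φ*-pre n ⟨
  φ* (pre (suc n))                             ∎
  where
  open ≡-Reasoning
  at-queue : At (suc n) (queue n)
  at-queue = queue-At n (queue n) [] (sym (++-identityʳ _))

scale-suc : ∀ n → scale (suc n) ≡ scale n + length (φ (t n))
scale-suc n = trans (cong length (φ*-pre-suc n)) (length-++ (φ* (pre n)))

At-φ : ∀ n → At (scale n) (φ (t n))
At-φ n = At-pre (scale n) (φ (t n)) (begin
  pre (scale n + length (φ (t n))) ≡⟨ cong pre (scale-suc n) ⟨
  pre (scale (suc n))              ≡⟨ pre-scale (suc n) ⟩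
  φ* (pre (suc n))                 ≡⟨ φ*-pre-suc n ⟩
  φ* (pre n) ++ φ (t n)            ≡⟨ cong (_++ φ (t n)) (pre-scale n) ⟨
  pre (scale n) ++ φ (t n)         ∎)
  where open ≡-Reasoning

At-φ* : ∀ n w → At n w → At (scale n) (φ* w)
At-φ* n []      _           = tt
At-φ* n (x ∷ w) (refl , at) = At-++ (scale n) (φ x) (φ* w) (At-φ n)
  (subst (λ k → At k (φ* w)) (scale-suc n) (At-φ* (suc n) w at))

-- Position `n` falls into the image of the letter at `index`; `before` and `after` are the rest of
-- that image on either side of it.
record Parent (n : ℕ) : Set where
  constructor parent
  field
    index        : ℕ
    before after : Word
    split        : φ (t index) ≡ before ++ t n ∷ after
    position     : n ≡ scale index + length before

φ-nonEmpty : ∀ x → NonEmpty (φ x)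
φ-nonEmpty l0 = l0 , [ l1 ] , refl
φ-nonEmpty l1 = l0 , [ l2 ] , refl
φ-nonEmpty l2 = l0 , [] , refl

At-split : ∀ i u y v → φ (t i) ≡ u ++ y ∷ v → t (scale i + length u) ≡ y
At-split i u y v eq = proj₁ (At-++ʳ (scale i) u (y ∷ v) (subst (At (scale i)) eq (At-φ i)))

parentOf : ∀ n → Parent n
parentOf zero    = parent 0 [] [ l1 ] refl refl
parentOf (suc n) with parentOf n
-- The current image still has a letter `y`, so the parent stays the same.
... | parent i u (y ∷ v) split pos = parent i (u ++ [ t n ]) v
  (trans split′ (cong (λ z → (u ++ [ t n ]) ++ z ∷ v) (sym at))) pos′
  where
  split′ : φ (t i) ≡ (u ++ [ t n ]) ++ y ∷ v
  split′ = trans split (sym (++-assoc u [ t n ] (y ∷ v)))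
  pos′ : suc n ≡ scale i + length (u ++ [ t n ])
  pos′ = begin
    suc n                            ≡⟨ cong suc pos ⟩
    suc (scale i + length u)         ≡⟨ +-suc (scale i) (length u) ⟨
    scale i + suc (length u)         ≡⟨ cong (scale i +_) (+-comm 1 (length u)) ⟩
    scale i + (length u + 1)         ≡⟨ cong (scale i +_) (length-++ u) ⟨
    scale i + length (u ++ [ t n ])  ∎
    where open ≡-Reasoning
  at : t (suc n) ≡ y
  at = trans (cong t pos′) (At-split i (u ++ [ t n ]) y v split′)
-- The current image is used up, so the next position opens the image of letter `suc i`.
... | parent i u [] split pos with φ-nonEmpty (t (suc i))
... | y , v , eq = parent (suc i) [] v (trans eq (cong (_∷ v) (sym at))) pos′
  where
  pos′ : suc n ≡ scale (suc i) + 0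
  pos′ = begin
    suc n                              ≡⟨ cong suc pos ⟩
    suc (scale i + length u)           ≡⟨ +-suc (scale i) (length u) ⟨
    scale i + suc (length u)           ≡⟨ cong (scale i +_) (+-comm 1 (length u)) ⟩
    scale i + (length u + 1)           ≡⟨ cong (scale i +_) (length-++ u) ⟨
    scale i + length (u ++ [ t n ])    ≡⟨ cong (λ w → scale i + length w) split ⟨
    scale i + length (φ (t i))         ≡⟨ scale-suc i ⟨
    scale (suc i)                      ≡⟨ +-identityʳ _ ⟨
    scale (suc i) + 0                  ∎
    where open ≡-Reasoning
  at : t (suc n) ≡ y
  at = trans (cong t pos′) (At-split (suc i) [] y v eq)

-- The image of `t 0` = `l0` has two letters and every later image at least one. Hence the parent of
-- a positive position is strictly smaller, which makes induction along parents well founded.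
i<scale : ∀ i → suc i < scale (suc i)
i<scale zero    = s≤s (s≤s z≤n)
i<scale (suc i) with φ-nonEmpty (t (suc i)) | scale-suc (suc i)
... | y , v , eq | sc rewrite sc | eq | +-suc (scale (suc i)) (length v) =
  s≤s (≤-trans (i<scale i) (m≤m+n _ _))

index< : ∀ n (p : Parent (suc n)) → Parent.index p < suc n
index< n (parent zero    _ _ _ _)   = s≤s z≤n
index< n (parent (suc i) u _ _ pos) =
  subst (suc i <_) (sym pos) (≤-trans (i<scale i) (m≤m+n _ _))

-- Every `φ x` contains `l0` exactly once, as its first letter; all other splits of an image are
-- absurd.
t≡l0⇒scale : ∀ n → t n ≡ l0 → ∃ λ j → n ≡ scale j
t≡l0⇒scale n e with parentOf n
... | parent i u v split pos with t i | t n | e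
t≡l0⇒scale n e | parent i []          v split pos | _  | .l0 | refl = i , trans pos (+-identityʳ _)
t≡l0⇒scale n e | parent i (_ ∷ [])    v ()    pos | l0 | .l0 | refl
t≡l0⇒scale n e | parent i (_ ∷ [])    v ()    pos | l1 | .l0 | refl
t≡l0⇒scale n e | parent i (_ ∷ [])    v ()    pos | l2 | .l0 | refl
t≡l0⇒scale n e | parent i (_ ∷ _ ∷ []) v ()   pos | l0 | .l0 | refl
t≡l0⇒scale n e | parent i (_ ∷ _ ∷ []) v ()   pos | l1 | .l0 | refl
t≡l0⇒scale n e | parent i (_ ∷ _ ∷ _ ∷ _) v () pos | l0 | .l0 | refl
t≡l0⇒scale n e | parent i (_ ∷ _ ∷ _ ∷ _) v () pos | l1 | .l0 | refl

scale⇒t≡l0 : ∀ j → t (scale j) ≡ l0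
scale⇒t≡l0 j with t j | At-φ j
... | l0 | e , _ = e
... | l1 | e , _ = e
... | l2 | e , _ = e

-- `l1` arises only as the second letter of `φ l0`, and that `l0` is itself the start of an image;
-- this gives two levels of `scale` and an offset of one.
t≡l1⇒scale² : ∀ n → t n ≡ l1 → ∃ λ j → n ≡ suc (scale (scale j))
t≡l1⇒scale² n e with parentOf n
... | parent i u v split pos with t i in ti | t n | e
t≡l1⇒scale² n e | parent i []           v ()    pos | l0 | .l1 | refl
t≡l1⇒scale² n e | parent i []           v ()    pos | l1 | .l1 | refl
t≡l1⇒scale² n e | parent i []           v ()    pos | l2 | .l1 | refl
t≡l1⇒scale² n e | parent i (_ ∷ [])     v split pos | l0 | .l1 | refl
  with j , refl ← t≡l0⇒scale i ti = j , trans pos (+-comm _ 1)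
t≡l1⇒scale² n e | parent i (_ ∷ [])     v ()    pos | l1 | .l1 | refl
t≡l1⇒scale² n e | parent i (_ ∷ [])     v ()    pos | l2 | .l1 | refl
t≡l1⇒scale² n e | parent i (_ ∷ _ ∷ []) v ()    pos | l0 | .l1 | refl
t≡l1⇒scale² n e | parent i (_ ∷ _ ∷ []) v ()    pos | l1 | .l1 | refl
t≡l1⇒scale² n e | parent i (_ ∷ _ ∷ _ ∷ _) v () pos | l0 | .l1 | refl
t≡l1⇒scale² n e | parent i (_ ∷ _ ∷ _ ∷ _) v () pos | l1 | .l1 | refl

At-φ-l0 : ∀ j → t j ≡ l0 → t (suc (scale j)) ≡ l1
At-φ-l0 j e with t j | e | At-φ j
... | .l0 | refl | _ , e₁ , _ = e₁

scale²⇒t≡l1 : ∀ j → t (suc (scale (scale j))) ≡ l1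
scale²⇒t≡l1 j = At-φ-l0 (scale j) (scale⇒t≡l0 j)

-- Linear functionals of letter counts

weight : ℕ → ℕ → ℕ → Letter → ℕ
weight p q r l0 = p
weight p q r l1 = q
weight p q r l2 = r

wt : ℕ → ℕ → ℕ → Word → ℕ
wt p q r []      = 0
wt p q r (x ∷ w) = weight p q r x + wt p q r w

wt-++ : ∀ p q r u v → wt p q r (u ++ v) ≡ wt p q r u + wt p q r v
wt-++ p q r []      v = refl
wt-++ p q r (x ∷ u) v =
  trans (cong (weight p q r x +_) (wt-++ p q r u v)) (sym (+-assoc (weight p q r x) _ _))

length≡wt : ∀ w → length w ≡ wt 1 1 1 w
length≡wt []       = refl
length≡wt (l0 ∷ w) = cong suc (length≡wt w)
length≡wt (l1 ∷ w) = cong suc (length≡wt w)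
length≡wt (l2 ∷ w) = cong suc (length≡wt w)

-- Pullback of a functional along φ, that is, the transposed incidence matrix acting on weights.
wt-φ* : ∀ p q r w → wt p q r (φ* w) ≡ wt (p + q) (p + r) p w
wt-φ* p q r []       = refl
wt-φ* p q r (l0 ∷ w) = trans (cong (λ k → p + (q + k)) (wt-φ* p q r w)) (sym (+-assoc p q _))
wt-φ* p q r (l1 ∷ w) = trans (cong (λ k → p + (r + k)) (wt-φ* p q r w)) (sym (+-assoc p r _))
wt-φ* p q r (l2 ∷ w) = cong (p +_) (wt-φ* p q r w)

-- Reduces every functional to the three letter counts, so that linear identities between
-- functionals can be left to the ring solver.
wt-basis : ∀ p q r w → wt p q r w ≡ p * wt 1 0 0 w + q * wt 0 1 0 w + r * wt 0 0 1 w
wt-basis p q r []       = zeros p q r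
  where
  zeros : ∀ p q r → 0 ≡ p * 0 + q * 0 + r * 0
  zeros = solve-∀
wt-basis p q r (l0 ∷ w) = trans (cong (p +_) (wt-basis p q r w)) (shift p q r _ _ _)
  where
  shift : ∀ p q r x y z → p + (p * x + q * y + r * z) ≡ p * suc x + q * y + r * z
  shift = solve-∀
wt-basis p q r (l1 ∷ w) = trans (cong (q +_) (wt-basis p q r w)) (shift p q r _ _ _)
  where
  shift : ∀ p q r x y z → q + (p * x + q * y + r * z) ≡ p * x + q * suc y + r * z
  shift = solve-∀
wt-basis p q r (l2 ∷ w) = trans (cong (r +_) (wt-basis p q r w)) (shift p q r _ _ _)
  where
  shift : ∀ p q r x y z → r + (p * x + q * y + r * z) ≡ p * x + q * y + r * suc z
  shift = solve-∀

wt-+ : ∀ p q r p′ q′ r′ w → wt (p + p′) (q + q′) (r + r′) w ≡ wt p q r w + wt p′ q′ r′ w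
wt-+ p q r p′ q′ r′ w
  rewrite wt-basis (p + p′) (q + q′) (r + r′) w | wt-basis p q r w | wt-basis p′ q′ r′ w =
  distrib p q r p′ q′ r′ (wt 1 0 0 w) (wt 0 1 0 w) (wt 0 0 1 w)
  where
  distrib : ∀ p q r p′ q′ r′ x y z →
    (p + p′) * x + (q + q′) * y + (r + r′) * z ≡
    (p * x + q * y + r * z) + (p′ * x + q′ * y + r′ * z)
  distrib = solve-∀

-- Two pairs of complementary sequences

-- The weights (1,2,1) and (2,1,1) are the length plus #1 and the length plus #0; (5,4,3) = (1,2,1)
-- + 2(2,1,1) and (3,3,2) = (1,2,1) + (2,1,1). The constants are the values at index 0, where no
-- letter has been counted.
A B E F : ℕ → ℕ
A n = 1 + wt 1 2 1 (pre n)
B n = 3 + wt 5 4 3 (pre n)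
E n = 1 + wt 2 1 1 (pre n)
F n = 2 + wt 3 3 2 (pre n)

B≡A+2E : ∀ n → B n ≡ A n + (E n + E n)
B≡A+2E n rewrite wt-basis 5 4 3 (pre n) | wt-basis 1 2 1 (pre n) | wt-basis 2 1 1 (pre n) =
  lemma (wt 1 0 0 (pre n)) (wt 0 1 0 (pre n)) (wt 0 0 1 (pre n))
  where
  lemma : ∀ x y z → 3 + (5 * x + 4 * y + 3 * z) ≡
    1 + (1 * x + 2 * y + 1 * z) + (1 + (2 * x + 1 * y + 1 * z) + (1 + (2 * x + 1 * y + 1 * z)))
  lemma = solve-∀

F≡A+E : ∀ n → F n ≡ A n + E n
F≡A+E n rewrite wt-basis 3 3 2 (pre n) | wt-basis 1 2 1 (pre n) | wt-basis 2 1 1 (pre n) =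
  lemma (wt 1 0 0 (pre n)) (wt 0 1 0 (pre n)) (wt 0 0 1 (pre n))
  where
  lemma : ∀ x y z → 2 + (3 * x + 3 * y + 2 * z) ≡
    1 + (1 * x + 2 * y + 1 * z) + (1 + (2 * x + 1 * y + 1 * z))
  lemma = solve-∀

A+B≡2F : ∀ n → A n + B n ≡ F n + F n
A+B≡2F n = begin
  A n + B n                 ≡⟨ cong (A n +_) (B≡A+2E n) ⟩
  A n + (A n + (E n + E n)) ≡⟨ lemma (A n) (E n) ⟩
  (A n + E n) + (A n + E n) ≡⟨ cong₂ _+_ (F≡A+E n) (F≡A+E n) ⟨
  F n + F n                 ∎
  where
  open ≡-Reasoning
  lemma : ∀ a e → a + (a + (e + e)) ≡ (a + e) + (a + e)
  lemma = solve-∀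

wt-pre-suc : ∀ p q r n → wt p q r (pre (suc n)) ≡ wt p q r (pre n) + weight p q r (t n)
wt-pre-suc p q r n =
  trans (wt-++ p q r (pre n) [ t n ]) (cong (wt p q r (pre n) +_) (+-identityʳ _))

-- `E` jumps by 2 exactly at the letters `l0`, that is, at image starts. Since (2,1,1)∘φ = (3,3,2),
-- the number jumped over is `F j`.
E-scale : ∀ j → suc (E (scale j)) ≡ F j
E-scale j rewrite pre-scale j = cong (2 +_) (wt-φ* 2 1 1 (pre j))

-- `A` jumps by 2 exactly at the letters `l1`. Since (1,2,1)∘φ² = (5,4,3), the number jumped over is
-- `B j`; the `l0` just before that `l1` contributes the extra 1.
A-scale² : ∀ j → suc (A (suc (scale (scale j)))) ≡ B j
A-scale² j = cong (2 +_) (begin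
  wt 1 2 1 (pre (suc (scale (scale j))))
    ≡⟨ wt-pre-suc 1 2 1 (scale (scale j)) ⟩
  wt 1 2 1 (pre (scale (scale j))) + weight 1 2 1 (t (scale (scale j)))
    ≡⟨ cong₂ _+_ (cong (wt 1 2 1) (pre-scale (scale j)))
                 (cong (weight 1 2 1) (scale⇒t≡l0 (scale j))) ⟩
  wt 1 2 1 (φ* (pre (scale j))) + 1
    ≡⟨ cong (_+ 1) (wt-φ* 1 2 1 (pre (scale j))) ⟩
  wt 3 2 1 (pre (scale j)) + 1
    ≡⟨ cong (λ w → wt 3 2 1 w + 1) (pre-scale j) ⟩
  wt 3 2 1 (φ* (pre j)) + 1
    ≡⟨ cong (_+ 1) (wt-φ* 3 2 1 (pre j)) ⟩
  wt 5 4 3 (pre j) + 1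
    ≡⟨ +-comm _ 1 ⟩
  suc (wt 5 4 3 (pre j)) ∎)
  where open ≡-Reasoning

-- A sequence that starts at 1 and has steps `1 + δ n`. If `δ` takes only the values 0 and 1, the
-- positive integers missed by `g` are the numbers `suc (g n)` with `δ n ≡ 1`. Both complementary
-- pairs are instances.
module Increments (g δ : ℕ → ℕ) (g-0 : g 0 ≡ 1) (g-suc : ∀ n → g (suc n) ≡ suc (g n + δ n)) where

  <-suc : ∀ n → g n < g (suc n)
  <-suc n = subst (g n <_) (sym (g-suc n)) (s≤s (m≤m+n (g n) (δ n)))

  mono≤ : ∀ {m n} → m ≤ n → g m ≤ g n
  mono≤ {m} {zero}  z≤n = ≤-refl
  mono≤ {m} {suc n} m≤sn with m ≟ suc n
  ... | yes refl = ≤-refl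
  ... | no  m≢   = ≤-trans (mono≤ (≤-pred (≤∧≢⇒< m≤sn m≢))) (<⇒≤ (<-suc n))

  mono< : ∀ {m n} → m < n → g m < g n
  mono< {m} m<n = ≤-trans (<-suc m) (mono≤ m<n)

  cancel< : ∀ m n → g m < g n → m < n
  cancel< m n lt with <-≤-connex m n
  ... | inj₁ m<n = m<n
  ... | inj₂ n≤m = ⊥-elim (<⇒≱ lt (mono≤ n≤m))

  injective : ∀ m n → g m ≡ g n → m ≡ n
  injective m n eq with <-cmp m n
  ... | tri< m<n _ _ = ⊥-elim (<⇒≢ (mono< m<n) eq)
  ... | tri≈ _ m≡n _ = m≡n
  ... | tri> _ _ n<m = ⊥-elim (<⇒≢ (mono< n<m) (sym eq))

  skips : ∀ m n → δ n ≡ 1 → g m ≢ suc (g n)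
  skips m n δ≡1 eq with <-≤-connex n m
  ... | inj₂ m≤n = <⇒≢ (s≤s (mono≤ m≤n)) eq
  ... | inj₁ n<m = <⇒≢ (subst (_≤ g m) g-suc-n (mono≤ n<m)) (sym eq)
    where
    g-suc-n : g (suc n) ≡ suc (suc (g n))
    g-suc-n = trans (g-suc n) (cong suc (trans (cong (g n +_) δ≡1) (+-comm (g n) 1)))

  covers : (∀ n → δ n ≡ 0 ⊎ δ n ≡ 1) →
           ∀ k → ∃ λ n → suc k ≡ g n ⊎ (δ n ≡ 1 × suc k ≡ suc (g n))
  covers δ-01 zero    = 0 , inj₁ (sym g-0)
  covers δ-01 (suc k) with covers δ-01 k
  ... | n , inj₂ (δ≡1 , eq) = suc n , inj₁ (begin
    suc (suc k)        ≡⟨ cong suc eq ⟩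
    suc (suc (g n))    ≡⟨ cong suc (+-comm 1 (g n)) ⟩
    suc (g n + 1)      ≡⟨ cong (λ d → suc (g n + d)) δ≡1 ⟨
    suc (g n + δ n)    ≡⟨ g-suc n ⟨
    g (suc n)          ∎)
    where open ≡-Reasoning
  ... | n , inj₁ eq with δ-01 n
  ... | inj₂ δ≡1 = n , inj₂ (δ≡1 , cong suc eq)
  ... | inj₁ δ≡0 = suc n , inj₁ (begin
    suc (suc k)        ≡⟨ cong suc eq ⟩
    suc (g n)          ≡⟨ cong suc (+-identityʳ (g n)) ⟨
    suc (g n + 0)      ≡⟨ cong (λ d → suc (g n + d)) δ≡0 ⟨
    suc (g n + δ n)    ≡⟨ g-suc n ⟨
    g (suc n)          ∎)
    where open ≡-Reasoning

module A where
  δ : ℕ → ℕ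
  δ n = weight 0 1 0 (t n)

  suc-δ : ∀ n → A (suc n) ≡ suc (A n + δ n)
  suc-δ n rewrite wt-pre-suc 1 2 1 n with t n
  ... | l0 = cong suc (+-suc _ 0)
  ... | l1 = cong suc (+-suc _ 1)
  ... | l2 = cong suc (+-suc _ 0)

  open Increments A δ refl suc-δ public

module E where
  δ : ℕ → ℕ
  δ n = weight 1 0 0 (t n)

  suc-δ : ∀ n → E (suc n) ≡ suc (E n + δ n)
  suc-δ n rewrite wt-pre-suc 2 1 1 n with t n
  ... | l0 = cong suc (+-suc _ 1)
  ... | l1 = cong suc (+-suc _ 0)
  ... | l2 = cong suc (+-suc _ 0)

  open Increments E δ refl suc-δ public

A≢B : ∀ m n → A m ≢ B n
A≢B m n eq = A.skips m (suc (scale (scale n))) (cong (weight 0 1 0) (scale²⇒t≡l1 n))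
  (trans eq (sym (A-scale² n)))

E≢F : ∀ m n → E m ≢ F n
E≢F m n eq = E.skips m (scale n) (cong (weight 1 0 0) (scale⇒t≡l0 n))
  (trans eq (sym (E-scale n)))

A⊎B : ∀ k → (∃ λ n → suc k ≡ A n) ⊎ (∃ λ n → suc k ≡ B n)
A⊎B k with A.covers δ-01 k
  where
  δ-01 : ∀ n → A.δ n ≡ 0 ⊎ A.δ n ≡ 1
  δ-01 n with t n
  ... | l0 = inj₁ refl
  ... | l1 = inj₂ refl
  ... | l2 = inj₁ refl
... | n , inj₁ eq         = inj₁ (n , eq)
... | n , inj₂ (δ≡1 , eq) with t n in tn
... | l1 with j , refl ← t≡l1⇒scale² n tn = inj₂ (j , trans eq (A-scale² j))

E⊎F : ∀ k → (∃ λ n → suc k ≡ E n) ⊎ (∃ λ n → suc k ≡ F n)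
E⊎F k with E.covers δ-01 k
  where
  δ-01 : ∀ n → E.δ n ≡ 0 ⊎ E.δ n ≡ 1
  δ-01 n with t n
  ... | l0 = inj₂ refl
  ... | l1 = inj₁ refl
  ... | l2 = inj₁ refl
... | n , inj₁ eq         = inj₁ (n , eq)
... | n , inj₂ (δ≡1 , eq) with t n in tn
... | l0 with j , refl ← t≡l0⇒scale n tn = inj₂ (j , trans eq (E-scale j))

-- The game

data Start : ℕ → ℕ → ℕ → ℕ → Set where
  self : ∀ {x y} → Start x y x y
  left : ∀ {x y} → Start (suc x) y x y
  down : ∀ {x y} → Start x (suc y) x y

-- Subtraction-free form of the moves: a diagonal move adds the same `s` to both target coordinates,
-- and an antidiagonal target has coordinate sum equal to the difference of the starting
-- coordinates.
data Move (x y x′ y′ : ℕ) : Set where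
  row  : x′ < x → y′ ≡ y → Move x y x′ y′
  col  : y′ < y → x′ ≡ x → Move x y x′ y′
  diag : ∀ {u v} s → Start x y u v → u ≡ x′ + s → v ≡ y′ + s → x′ + y′ < x + y → Move x y x′ y′
  low  : ∀ {u v} → Start x y u v → 0 < x′ → v ≡ u + (x′ + y′) → x′ + y′ < x + y → Move x y x′ y′
  high : ∀ {u v} → Start x y u v → 0 < y′ → u ≡ v + (x′ + y′) → x′ + y′ < x + y → Move x y x′ y′

Move-sum : ∀ {x y x′ y′} → Move x y x′ y′ → x′ + y′ < x + y
Move-sum {y = y} (row lt refl) = +-monoˡ-< y lt
Move-sum {x}     (col lt refl) = +-monoʳ-< x lt
Move-sum (diag _ _ _ _ lt)     = lt
Move-sum (low _ _ _ lt)        = lt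
Move-sum (high _ _ _ lt)       = lt

Start-sym : ∀ {x y u v} → Start x y u v → Start y x v u
Start-sym self = self
Start-sym left = down
Start-sym down = left

Move-sym : ∀ {x y x′ y′} → Move x y x′ y′ → Move y x y′ x′
Move-sym (row lt eq) = col lt eq
Move-sym (col lt eq) = row lt eq
Move-sym {x} {y} {x′} {y′} (diag s st e₁ e₂ lt) =
  diag s (Start-sym st) e₂ e₁ (subst₂ _<_ (+-comm x′ y′) (+-comm x y) lt)
Move-sym {x} {y} {x′} {y′} (low {u} st pos eq lt) =
  high (Start-sym st) pos (trans eq (cong (u +_) (+-comm x′ y′)))
    (subst₂ _<_ (+-comm x′ y′) (+-comm x y) lt)
Move-sym {x} {y} {x′} {y′} (high {v = v} st pos eq lt) =
  low (Start-sym st) pos (trans eq (cong (v +_) (+-comm x′ y′)))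
    (subst₂ _<_ (+-comm x′ y′) (+-comm x y) lt)

-- The list of moves agrees with the relation `Move`

starts⁺ : ∀ {x y u v} → Start x y u v → (u , v) ∈ starts x y
starts⁺ self           = here refl
starts⁺ left           = there (here refl)
starts⁺ {zero}  down = there (here refl)
starts⁺ {suc x} down = there (there (here refl))

starts⁻ : ∀ x y {u v} → (u , v) ∈ starts x y → Start x y u v
starts⁻ x       y       (here refl)                 = self
starts⁻ (suc x) y       (there (here refl))         = left
starts⁻ zero    (suc y) (there (here refl))         = down
starts⁻ (suc x) (suc y) (there (there (here refl))) = down

<ᵇ-true : ∀ {m n} → m < n → (m <ᵇ n) ≡ true
<ᵇ-true {m} {n} lt with m <ᵇ n | <⇒<ᵇ lt
... | true | _ = refl

<ᵇ-false : ∀ {m n} → n ≤ m → (m <ᵇ n) ≡ false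
<ᵇ-false {m} {n} le with m <ᵇ n in eq
... | false = refl
... | true  = ⊥-elim (<⇒≱ (<ᵇ⇒< m n (subst T (sym eq) _)) le)

diagonal antidiagonal : ℕ → ℕ → List Pos
diagonal u v = map (λ s → (u ∸ s , v ∸ s)) (upTo (suc (u ⊓ v)))
antidiagonal u v =
  if u <ᵇ v then map (λ k → (k , (v ∸ u) ∸ k)) (map suc (upTo (v ∸ u)))
  else if v <ᵇ u then map (λ k → ((u ∸ v) ∸ k , k)) (map suc (upTo (u ∸ v)))
  else []

diagonal⁺ : ∀ x′ y′ s → (x′ , y′) ∈ diagonal (x′ + s) (y′ + s)
diagonal⁺ x′ y′ s =
  subst₂ (λ a b → (a , b) ∈ diagonal (x′ + s) (y′ + s)) (m+n∸n≡m x′ s) (m+n∸n≡m y′ s)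
    (∈-map⁺ (λ s′ → (x′ + s ∸ s′ , y′ + s ∸ s′))
      (∈-upTo⁺ (s≤s (⊓-glb (m≤n+m s x′) (m≤n+m s y′)))))

low⁺ : ∀ u x′ y′ → (suc x′ , y′) ∈ antidiagonal u (u + (suc x′ + y′))
low⁺ u x′ y′
  rewrite <ᵇ-true (m<m+n u {suc x′ + y′} (s≤s z≤n)) | m+n∸m≡n u (suc x′ + y′) =
  subst (λ b → (suc x′ , b) ∈ cells) (m+n∸m≡n x′ y′)
    (∈-map⁺ cell (∈-map⁺ suc (∈-upTo⁺ (s≤s (m≤m+n x′ y′)))))
  where
  cell : ℕ → Pos
  cell k = k , suc (x′ + y′) ∸ k
  cells : List Pos
  cells = map cell (map suc (upTo (suc (x′ + y′))))

high⁺ : ∀ v x′ y′ → (x′ , suc y′) ∈ antidiagonal (v + (x′ + suc y′)) v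
high⁺ v x′ y′
  rewrite <ᵇ-false (m≤m+n v (x′ + suc y′))
        | <ᵇ-true (m<m+n v {x′ + suc y′} (≤-trans (s≤s z≤n) (m≤n+m (suc y′) x′)))
        | m+n∸m≡n v (x′ + suc y′) =
  subst (λ b → (b , suc y′) ∈ cells) (m+n∸n≡m x′ (suc y′))
    (∈-map⁺ cell (∈-map⁺ suc (∈-upTo⁺ (m≤n+m (suc y′) x′))))
  where
  cell : ℕ → Pos
  cell k = (x′ + suc y′) ∸ k , k
  cells : List Pos
  cells = map cell (map suc (upTo (x′ + suc y′)))

targets : ℕ → ℕ → List Pos
targets x y = rookMoves x y ++ concatMap fromStart (starts x y)

smaller? : ∀ x y (p : Pos) → Dec (T ((proj₁ p + proj₂ p) <ᵇ (x + y)))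
smaller? x y p = T? ((proj₁ p + proj₂ p) <ᵇ (x + y))

moves⁺ : ∀ {x y x′ y′} → Move x y x′ y′ → (x′ , y′) ∈ moves x y
moves⁺ {x} {y} {x′} {y′} mv =
  ∈-filter⁺ (smaller? x y) {xs = targets x y} (go mv) (<⇒<ᵇ (Move-sum mv))
  where
  via : ∀ {u v} → Start x y u v → (x′ , y′) ∈ fromStart (u , v) →
        (x′ , y′) ∈ targets x y
  via st ∈from = ∈-++⁺ʳ (rookMoves x y)
    (concatMap⁺ fromStart (Any.map (λ { refl → ∈from }) (starts⁺ st)))
  go : Move x y x′ y′ → (x′ , y′) ∈ targets x y
  go (row lt refl) = ∈-++⁺ˡ (∈-++⁺ˡ (∈-map⁺ (_, y) (∈-upTo⁺ lt)))
  go (col lt refl) = ∈-++⁺ˡ (∈-++⁺ʳ (map (_, y) (upTo x)) (∈-map⁺ (x ,_) (∈-upTo⁺ lt)))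
  go (diag s st refl refl _) = via st (∈-++⁺ˡ (diagonal⁺ x′ y′ s))
  go (low {u} st (s≤s {n = k} z≤n) refl _) =
    via st (∈-++⁺ʳ (diagonal u (u + (suc k + y′))) (low⁺ u k y′))
  go (high {v = v} st (s≤s {n = k} z≤n) refl _) =
    via st (∈-++⁺ʳ (diagonal (v + (x′ + suc k)) v) (high⁺ v x′ k))

fromStart⁻ : ∀ {x y x′ y′} u v → Start x y u v → x′ + y′ < x + y →
             (x′ , y′) ∈ fromStart (u , v) → Move x y x′ y′
fromStart⁻ {x} {y} {x′} {y′} u v st lt mem with ∈-++⁻ (diagonal u v) mem
... | inj₁ m with ∈-map⁻ _ {xs = upTo (suc (u ⊓ v))} m
... | s , s∈ , refl = diag s st
  (sym (m∸n+n≡m (≤-trans s≤ (m⊓n≤m u v)))) (sym (m∸n+n≡m (≤-trans s≤ (m⊓n≤n u v)))) lt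
  where
  s≤ : s ≤ u ⊓ v
  s≤ = ≤-pred (∈-upTo⁻ s∈)
fromStart⁻ {x} {y} {x′} {y′} u v st lt mem | inj₂ m with u <ᵇ v in u<v
... | true with ∈-map⁻ _ m
... | t , t∈ , refl with ∈-map⁻ suc t∈
... | k , k∈ , refl = low st (s≤s z≤n)
  (sym (trans (cong (u +_) (m+[n∸m]≡n (∈-upTo⁻ k∈)))
    (m+[n∸m]≡n (<⇒≤ (<ᵇ⇒< u v (subst T (sym u<v) _)))))) lt
fromStart⁻ {x} {y} {x′} {y′} u v st lt mem | inj₂ m | false with v <ᵇ u in v<u
... | true with ∈-map⁻ _ m
... | t , t∈ , refl with ∈-map⁻ suc t∈
... | k , k∈ , refl = high st (s≤s z≤n)
  (sym (trans (cong (v +_) (m∸n+n≡m (∈-upTo⁻ k∈)))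
    (m+[n∸m]≡n (<⇒≤ (<ᵇ⇒< v u (subst T (sym v<u) _)))))) lt
fromStart⁻ u v st lt mem | inj₂ () | false | false

moves⁻ : ∀ {x y x′ y′} → (x′ , y′) ∈ moves x y → Move x y x′ y′
moves⁻ {x} {y} {x′} {y′} mem
  with ∈-filter⁻ (smaller? x y) {xs = targets x y} mem
... | mem′ , lt with ∈-++⁻ (rookMoves x y) mem′
... | inj₂ m with find (concatMap⁻ fromStart m)
... | (u , v) , p∈ , m′ = fromStart⁻ u v (starts⁻ x y p∈) (<ᵇ⇒< _ _ lt) m′
moves⁻ {x} {y} {x′} {y′} mem | mem′ , lt | inj₁ m with ∈-++⁻ (map (λ x' → (x' , y)) (upTo x)) m
... | inj₁ m′ with ∈-map⁻ _ m′
... | _ , x∈ , refl = row (∈-upTo⁻ x∈) refl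
moves⁻ {x} {y} {x′} {y′} mem | mem′ , lt | inj₁ m | inj₂ m′ with ∈-map⁻ _ m′
... | _ , y∈ , refl = col (∈-upTo⁻ y∈) refl

-- Kernels and P-positions

-- As moves decrease `x + y`, an independent and absorbing set is the set of P-positions. The two
-- inclusions go by simultaneous induction on the fuel, each using the other one level down.
module Kernel (K : ℕ → ℕ → Set)
  (independent : ∀ {x y x′ y′} → K x y → K x′ y′ → ¬ Move x y x′ y′)
  (absorbing : ∀ x y → K x y ⊎ ∃ λ x′ → ∃ λ y′ → K x′ y′ × Move x y x′ y′) where

  pAux⁺ : ∀ k {x y} → x + y ≤ k → K x y → T (pAux k x y)
  pAux⁻ : ∀ k {x y} → x + y ≤ k → T (pAux k x y) → K x y

  pAux⁺ zero    le Kxy = _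
  pAux⁺ (suc k) {x} {y} le Kxy with any (λ p → pAux k (proj₁ p) (proj₂ p)) (moves x y) in eq
  ... | false = _
  ... | true with find (any⁻ (λ p → pAux k (proj₁ p) (proj₂ p)) (moves x y) (subst T (sym eq) _))
  ... | (x′ , y′) , mem , Tp =
    independent Kxy (pAux⁻ k (≤-pred (≤-trans (Move-sum mv) le)) Tp) mv
    where
    mv : Move x y x′ y′
    mv = moves⁻ {x} {y} mem

  -- Without fuel the position is (0,0); no move leaves it, so absorption puts it into `K`.
  pAux⁻ zero {zero} {zero} le _ with absorbing 0 0
  ... | inj₁ K00 = K00
  ... | inj₂ (_ , _ , _ , mv) = ⊥-elim (n≮0 (Move-sum mv))
  pAux⁻ (suc k) {x} {y} le Tp with absorbing x y
  ... | inj₁ Kxy = Kxy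
  ... | inj₂ (x′ , y′ , K′ , mv) with any (λ p → pAux k (proj₁ p) (proj₂ p)) (moves x y)
         | any⁺ (λ p → pAux k (proj₁ p) (proj₂ p))
             (lose {xs = moves x y} (moves⁺ mv) (pAux⁺ k (≤-pred (≤-trans (Move-sum mv) le)) K′))
  ... | false | ()
  ... | true  | _ = ⊥-elim Tp

-- The P-positions form the kernel given by A and B

data K (x y : ℕ) : Set where
  origin : x ≡ 0 → y ≡ 0 → K x y
  lower  : ∀ n → x ≡ A n → y ≡ B n → K x y
  upper  : ∀ n → x ≡ B n → y ≡ A n → K x y

K-sym : ∀ {x y} → K x y → K y x
K-sym (origin ex ey)  = origin ey ex
K-sym (lower n ex ey) = upper n ey ex
K-sym (upper n ex ey) = lower n ey ex

A<B : ∀ n → A n < B n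
A<B n = subst (A n <_) (sym (B≡A+2E n)) (m<m+n (A n) (s≤s z≤n))

B-mono< : ∀ {m n} → m < n → B m < B n
B-mono< {m} {n} m<n = subst₂ _<_ (sym (B≡A+2E m)) (sym (B≡A+2E n))
  (+-mono-< (A.mono< m<n) (+-mono-< (E.mono< m<n) (E.mono< m<n)))

k+k-injective : ∀ {k l} → k + k ≡ l + l → k ≡ l
k+k-injective {k} {l} eq with <-cmp k l
... | tri< k<l _ _ = ⊥-elim (<⇒≢ (+-mono-< k<l k<l) eq)
... | tri≈ _ k≡l _ = k≡l
... | tri> _ _ l<k = ⊥-elim (<⇒≢ (+-mono-< l<k l<k) (sym eq))

odd≢even : ∀ k l → suc (k + k) ≢ l + l
odd≢even k       zero    ()
odd≢even zero    (suc l) eq = 0≢1+n (suc-injective (trans eq (+-suc (suc l) l)))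
odd≢even (suc k) (suc l) eq = odd≢even k l (suc-injective (suc-injective
  (trans (cong suc (sym (+-suc (suc k) k))) (trans eq (+-suc (suc l) l)))))

Near : ℕ → ℕ → Set
Near d e = d ≡ e + e ⊎ d ≡ suc (e + e) ⊎ suc d ≡ e + e

-- The shifted starting points change a difference by at most 1, but differences and sums of kernel
-- positions are even; parity removes this slack.
Near-even : ∀ {k e} → Near (k + k) e → k ≡ e
Near-even (inj₁ eq)                = k+k-injective eq
Near-even {k} {e} (inj₂ (inj₁ eq)) = ⊥-elim (odd≢even e k (sym eq))
Near-even {k} {e} (inj₂ (inj₂ eq)) = ⊥-elim (odd≢even k e eq)

-- The half-difference is written `suc e` so that the gap left by `down` is still a natural number.
start-gap : ∀ {x y u v} e → y ≡ x + (suc e + suc e) → Start x y u v →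
            ∃ λ d → v ≡ u + d × Near d (suc e)
start-gap e eq self = suc e + suc e , eq , inj₁ refl
start-gap {u = u} e eq left =
  suc (suc e + suc e) , trans eq (sym (+-suc u (suc e + suc e))) , inj₂ (inj₁ refl)
start-gap {x} e eq down =
  e + suc e , suc-injective (trans eq (+-suc x (e + suc e))) , inj₂ (inj₂ refl)

-- Rows and columns are excluded by monotonicity and `A≢B`. A diagonal preserves the difference, so
-- a lower target has `E m ≡ E n` and would be the starting position; the origin would need `E n`
-- zero, and an upper target lies on the wrong side. An antidiagonal target would give `F m ≡ E n`,
-- against complementarity; `high` would need `v < u`.
lower-stuck : ∀ n {x′ y′} → Move (A n) (B n) x′ y′ → ¬ K x′ y′
lower-stuck n (row lt eq) (origin _ refl) = 0≢1+n eq
lower-stuck n (row lt eq) (lower m refl refl) = <⇒≢ (B-mono< {m} {n} (A.cancel< m n lt)) eq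
lower-stuck n (row lt eq) (upper m refl refl) = A≢B m n eq
lower-stuck n (col lt eq) (origin refl _) = 0≢1+n eq
lower-stuck n (col lt eq) (lower m refl refl) = <⇒≢ lt (cong B {m} {n} (A.injective m n eq))
lower-stuck n (col lt eq) (upper m refl refl) = A≢B n m (sym eq)
lower-stuck n (diag {u} {v} s st eu ev lt) k
  with d , v≡u+d , near ← start-gap _ (B≡A+2E n) st = blocked k
  where
  blocked : ¬ K _ _
  blocked (origin refl refl) = 0≢1+n (Near-even {0} (subst (λ d → Near d (E n)) d≡0 near))
    where
    d≡0 : d ≡ 0
    d≡0 = +-cancelˡ-≡ u d 0 (trans (sym v≡u+d) (trans ev (trans (sym eu) (sym (+-identityʳ u)))))
  blocked (lower m refl refl) =
    <⇒≢ lt (cong (λ i → A i + B i) {m} {n}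
      (E.injective m n (Near-even (subst (λ d → Near d (E n)) d≡2E near))))
    where
    d≡2E : d ≡ E m + E m
    d≡2E = +-cancelˡ-≡ u _ _ (begin
      u + d                     ≡⟨ v≡u+d ⟨
      v                         ≡⟨ ev ⟩
      B m + s                   ≡⟨ cong (_+ s) (B≡A+2E m) ⟩
      A m + (E m + E m) + s     ≡⟨ swap (A m) (E m + E m) s ⟩
      A m + s + (E m + E m)     ≡⟨ cong (_+ (E m + E m)) eu ⟨
      u + (E m + E m)           ∎)
      where
      open ≡-Reasoning
      swap : ∀ a b c → a + b + c ≡ a + c + b
      swap = solve-∀
  blocked (upper m refl refl) = <⇒≱ v<u (subst (u ≤_) (sym v≡u+d) (m≤m+n u d))
    where
    v<u : v < u
    v<u = subst₂ _<_ (sym ev) (sym eu) (+-monoˡ-< s (A<B m))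
lower-stuck n {x′} {y′} (low {u} {v} st pos eq lt) k
  with d , v≡u+d , near ← start-gap _ (B≡A+2E n) st = blocked k
  where
  d≡sum : d ≡ x′ + y′
  d≡sum = +-cancelˡ-≡ u _ _ (trans (sym v≡u+d) eq)
  not-2F : ∀ m → x′ + y′ ≢ A m + B m
  not-2F m eq′ = E≢F n m (sym (Near-even
    (subst (λ d → Near d (E n)) (trans d≡sum (trans eq′ (A+B≡2F m))) near)))
  blocked : ¬ K x′ y′
  blocked (origin refl _)     = n≮0 pos
  blocked (lower m refl refl) = not-2F m refl
  blocked (upper m refl refl) = not-2F m (+-comm (B m) (A m))
lower-stuck n {x′} {y′} (high {u} {v} st pos eq lt) _
  with d , v≡u+d , _ ← start-gap _ (B≡A+2E n) st =
  <⇒≱ (subst (v <_) (sym eq) (m<m+n v (≤-trans pos (m≤n+m y′ x′))))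
      (subst (u ≤_) (sym v≡u+d) (m≤m+n u d))

independent : ∀ {x y x′ y′} → K x y → K x′ y′ → ¬ Move x y x′ y′
independent (origin refl refl)  k mv = n≮0 (Move-sum mv)
independent (lower n refl refl) k mv = lower-stuck n mv k
independent (upper n refl refl) k mv = lower-stuck n (Move-sym mv) (K-sym k)

half : ∀ d → ∃ λ k → d ≡ k + k ⊎ d ≡ suc (k + k)
half zero    = 0 , inj₁ refl
half (suc d) with half d
... | k , inj₁ eq = k , inj₂ (cong suc eq)
... | k , inj₂ eq = suc k , inj₁ (cong suc (trans eq (sym (+-suc k k))))

Escape : ℕ → ℕ → Set
Escape x y = K x y ⊎ ∃ λ x′ → ∃ λ y′ → K x′ y′ × Move x y x′ y′

Escape-sym : ∀ {x y} → Escape x y → Escape y x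
Escape-sym (inj₁ k)                  = inj₁ (K-sym k)
Escape-sym (inj₂ (x′ , y′ , k , mv)) = inj₂ (y′ , x′ , K-sym k , Move-sym mv)

-- An odd difference is rounded down to an even one by using the starting point one step below.
half-start : ∀ x {d} k → d ≡ k + k ⊎ d ≡ suc (k + k) → Start x (x + d) x (x + (k + k))
half-start x k (inj₁ refl) = self
half-start x k (inj₂ refl) = subst (λ y → Start x y x (x + (k + k))) (sym (+-suc x (k + k))) down

half-≤ : ∀ {d} k → d ≡ k + k ⊎ d ≡ suc (k + k) → k + k ≤ d
half-≤ k (inj₁ refl) = ≤-refl
half-≤ k (inj₂ refl) = n≤1+n _

-- Half the rounded difference is some `E m` or some `F m`. For `E m`, lying below `B n` forces
-- `m < n`, and the diagonal passes through (`A m`, `B m`). For `F m`, the antidiagonal contains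
-- (`A m`, `B m`), whose coordinates sum to `2 F m`.
escape-below : ∀ n k d → d ≡ suc k + suc k ⊎ d ≡ suc (suc k + suc k) → A n + d < B n →
               Escape (A n) (A n + d)
escape-below n k d halves lt with E⊎F k
... | inj₁ (m , k≡E) = inj₂ (A m , B m , lower m refl refl ,
  diag (A n ∸ A m) (half-start (A n) (suc k) halves) (sym (m+[n∸m]≡n (<⇒≤ Am<An))) v≡
    (+-mono-<-≤ Am<An Bm≤))
  where
  Em<En : E m < E n
  Em<En with <-≤-connex (E m) (E n)
  ... | inj₁ lt′   = lt′
  ... | inj₂ En≤Em = ⊥-elim (<⇒≱ lt (subst (_≤ A n + d) (sym (B≡A+2E n)) (+-monoʳ-≤ (A n)
    (≤-trans (+-mono-≤ En≤Em En≤Em) (subst (λ e → e + e ≤ d) k≡E (half-≤ (suc k) halves))))))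
  Am<An : A m < A n
  Am<An = A.mono< (E.cancel< m n Em<En)
  Bm≡ : B m ≡ A m + (suc k + suc k)
  Bm≡ = trans (B≡A+2E m) (cong (λ e → A m + (e + e)) (sym k≡E))
  Bm≤ : B m ≤ A n + d
  Bm≤ = subst (_≤ A n + d) (sym Bm≡) (+-mono-≤ (<⇒≤ Am<An) (half-≤ (suc k) halves))
  v≡ : A n + (suc k + suc k) ≡ B m + (A n ∸ A m)
  v≡ = begin
    A n + (suc k + suc k)                   ≡⟨ cong (_+ (suc k + suc k)) (m+[n∸m]≡n (<⇒≤ Am<An)) ⟨
    A m + (A n ∸ A m) + (suc k + suc k)     ≡⟨ swap (A m) (A n ∸ A m) (suc k + suc k) ⟩
    A m + (suc k + suc k) + (A n ∸ A m)     ≡⟨ cong (_+ (A n ∸ A m)) Bm≡ ⟨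
    B m + (A n ∸ A m)                       ∎
    where
    open ≡-Reasoning
    swap : ∀ a b c → a + b + c ≡ a + c + b
    swap = solve-∀
... | inj₂ (m , k≡F) = inj₂ (A m , B m , lower m refl refl ,
  low (half-start (A n) (suc k) halves) (s≤s z≤n) (cong (A n +_) (sym sum≡)) sum<)
  where
  sum≡ : A m + B m ≡ suc k + suc k
  sum≡ = trans (A+B≡2F m) (cong (λ f → f + f) (sym k≡F))
  sum< : A m + B m < A n + (A n + d)
  sum< = subst (_< A n + (A n + d)) (sym sum≡)
    (+-mono-<-≤ {0} (s≤s z≤n) (≤-trans (half-≤ (suc k) halves) (m≤n+m d (A n))))

-- Difference at most 1 lets the diagonal reach the origin. Otherwise `A⊎B` decides: a `B n` in the
-- first coordinate allows a drop to `A n` in the second, and for `A n` the second coordinate is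
-- compared with `B n`.
escape-≤ : ∀ x d → Escape x (x + d)
escape-≤ zero    zero    = inj₁ (origin refl refl)
escape-≤ zero    (suc d) = inj₂ (0 , 0 , origin refl refl , col (s≤s z≤n) refl)
escape-≤ (suc x) zero    = inj₂ (0 , 0 , origin refl refl ,
  diag (suc x) self refl (+-identityʳ _) (s≤s z≤n))
escape-≤ (suc x) (suc zero) = inj₂ (0 , 0 , origin refl refl ,
  diag (suc x) (half-start (suc x) 0 (inj₂ refl)) refl (+-identityʳ _) (s≤s z≤n))
escape-≤ (suc x) (suc (suc d)) with A⊎B x
... | inj₂ (n , x≡B) = inj₂ (suc x , A n , upper n x≡B refl ,
  col (≤-trans (subst (A n <_) (sym x≡B) (A<B n)) (m≤m+n _ _)) refl)
... | inj₁ (n , x≡A) with <-cmp (suc x + suc (suc d)) (B n)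
... | tri> _ _ gt = inj₂ (suc x , B n , lower n x≡A refl , col gt refl)
... | tri≈ _ eq _ = inj₁ (lower n x≡A eq)
... | tri< lt _ _ with half d
... | k , halves = subst (λ a → Escape a (a + suc (suc d))) (sym x≡A)
  (escape-below n k (suc (suc d)) (up halves) (subst (λ a → a + suc (suc d) < B n) x≡A lt))
  where
  up : d ≡ k + k ⊎ d ≡ suc (k + k) → suc (suc d) ≡ suc k + suc k ⊎ suc (suc d) ≡ suc (suc k + suc k)
  up (inj₁ refl) = inj₁ (cong suc (sym (+-suc k k)))
  up (inj₂ refl) = inj₂ (cong (λ e → suc (suc e)) (sym (+-suc k k)))

absorbing : ∀ x y → Escape x y
absorbing x y with ≤-total x y
... | inj₁ x≤y = subst (Escape x) (m+[n∸m]≡n x≤y) (escape-≤ x (y ∸ x))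
... | inj₂ y≤x = Escape-sym (subst (Escape y) (m+[n∸m]≡n y≤x) (escape-≤ y (x ∸ y)))

-- The listing of the P-positions

open Kernel K independent absorbing

listing : IsListing (λ n → A (n ∸ 1)) (λ n → B (n ∸ 1))
listing = increasing , sound , complete
  where
  increasing : ∀ n → 1 ≤ n → A (n ∸ 1) < A (suc n ∸ 1)
  increasing (suc n) _ = A.<-suc n
  sound : ∀ n → 1 ≤ n → IsP (A (n ∸ 1)) (B (n ∸ 1)) × 0 < A (n ∸ 1) × A (n ∸ 1) ≤ B (n ∸ 1)
  sound n _ = pAux⁺ _ ≤-refl (lower (n ∸ 1) refl refl) , s≤s z≤n , <⇒≤ (A<B (n ∸ 1))
  complete : ∀ x y → IsP x y → 0 < x → x ≤ y → Σ ℕ λ n → 1 ≤ n × A (n ∸ 1) ≡ x × B (n ∸ 1) ≡ y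
  complete x y P 0<x x≤y with pAux⁻ (x + y) ≤-refl P
  ... | origin refl _     = ⊥-elim (n≮0 0<x)
  ... | lower n refl refl = suc n , s≤s z≤n , refl , refl
  ... | upper n refl refl = ⊥-elim (<⇒≱ (A<B n) x≤y)

-- An automaton for the position B n in the Tribonacci word

_≟ˡ_ : DecidableEquality Letter
l0 ≟ˡ l0 = yes refl
l0 ≟ˡ l1 = no λ ()
l0 ≟ˡ l2 = no λ ()
l1 ≟ˡ l0 = no λ ()
l1 ≟ˡ l1 = yes refl
l1 ≟ˡ l2 = no λ ()
l2 ≟ˡ l0 = no λ ()
l2 ≟ˡ l1 = no λ ()
l2 ≟ˡ l2 = yes refl

State : Set
State = Letter × ℕ × ℕ × ℕ × Word

_≟ˢ_ : DecidableEquality State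
_≟ˢ_ = Product.≡-dec _≟ˡ_ (Product.≡-dec _≟_ (Product.≡-dec _≟_
         (Product.≡-dec _≟_ (List.≡-dec _≟ˡ_))))

open import Data.List.Membership.DecPropositional _≟ˢ_ using (_∈?_)

-- A state describes position n by the letter there and by a factor r of the word at some c that
-- lies a little to the left of B n.  The coefficients (2,2,1), (4,3,2) are (1,1,1)∘φ, (1,1,1)∘φ²
-- and (9,8,5), (17,14,9) are (5,4,3)∘φ, (5,4,3)∘φ².  As φ³ = φ² + φ + 1 on letter counts, the
-- three deficits are determined by those of the parent.
record _Represents_ (s : State) (n : ℕ) : Set where
  private
    x  = proj₁ s
    α₀ = proj₁ (proj₂ s)
    α₁ = proj₁ (proj₂ (proj₂ s))
    α₂ = proj₁ (proj₂ (proj₂ (proj₂ s)))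
    r  = proj₂ (proj₂ (proj₂ (proj₂ s)))
  field
    letter   : t n ≡ x
    c        : ℕ
    window   : At c r
    deficit₀ : wt 1 1 1 (pre c) + α₀ ≡ wt 5 4 3 (pre n)
    deficit₁ : wt 2 2 1 (pre c) + α₁ ≡ wt 9 8 5 (pre n)
    deficit₂ : wt 4 3 2 (pre c) + α₂ ≡ wt 17 14 9 (pre n)

splits : Word → List (Word × Letter)
splits []      = []
splits (x ∷ w) = ([] , x) ∷ map (λ (u , y) → x ∷ u , y) (splits w)

∈-splits : ∀ u y v → (u , y) ∈ splits (u ++ y ∷ v)
∈-splits []      y v = here refl
∈-splits (x ∷ u) y v = there (∈-map⁺ _ (∈-splits u y v))

-- A window starting one letter to the left of the position 5·#0 + 4·#1 + 3·#2 (or at it) and of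
-- length 8 covers the windows of all children.
shift : State → Word → ℕ
shift (_ , _ , α₁ , _ , _) u = α₁ + wt 5 4 3 u ∸ 1

skipped : State → Word → Word
skipped s@(_ , _ , _ , _ , r) u = take (shift s u) (φ* r)

step : State → Word × Letter → State
step s@(_ , α₀ , α₁ , α₂ , r) (u , y) =
  y , α₁ + wt 5 4 3 u ∸ wt 1 1 1 d
    , α₂ + wt 9 8 5 u ∸ wt 2 2 1 d
    , α₀ + α₁ + α₂ + wt 17 14 9 u ∸ wt 4 3 2 d
    , take 8 (drop (shift s u) (φ* r))
  where d = skipped s u

-- The truncated subtractions in step are exact.
Exact : State → Word → Set
Exact s@(_ , α₀ , α₁ , α₂ , _) u =
  wt 1 1 1 d ≤ α₁ + wt 5 4 3 u ×
  wt 2 2 1 d ≤ α₂ + wt 9 8 5 u ×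
  wt 4 3 2 d ≤ α₀ + α₁ + α₂ + wt 17 14 9 u
  where d = skipped s u

exact? : ∀ s u → Dec (Exact s u)
exact? s u = (_ ≤? _) ×-dec (_ ≤? _) ×-dec (_ ≤? _)

-- The deficit of a pair of functionals at a child is the deficit of their pullbacks along φ at the
-- parent, corrected by the partial images `u` and `d`.
deficit-step : ∀ p q r p′ q′ r′ i n c m {α} d u →
  pre m ≡ φ* (pre c) ++ d → pre n ≡ φ* (pre i) ++ u →
  wt (p + q) (p + r) p (pre c) + α ≡ wt (p′ + q′) (p′ + r′) p′ (pre i) →
  wt p q r d ≤ α + wt p′ q′ r′ u →
  wt p q r (pre m) + (α + wt p′ q′ r′ u ∸ wt p q r d) ≡ wt p′ q′ r′ (pre n)
deficit-step p q r p′ q′ r′ i n c m {α} d u pre-m pre-n deficit exact = begin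
  wt p q r (pre m) + (X ∸ wt p q r d)
    ≡⟨ cong (_+ (X ∸ wt p q r d)) (trans (cong (wt p q r) pre-m) (wt-++ p q r (φ* (pre c)) d)) ⟩
  wt p q r (φ* (pre c)) + wt p q r d + (X ∸ wt p q r d)
    ≡⟨ +-assoc (wt p q r (φ* (pre c))) _ _ ⟩
  wt p q r (φ* (pre c)) + (wt p q r d + (X ∸ wt p q r d))
    ≡⟨ cong₂ _+_ (wt-φ* p q r (pre c)) (m+[n∸m]≡n exact) ⟩
  wt (p + q) (p + r) p (pre c) + (α + wt p′ q′ r′ u)
    ≡⟨ +-assoc (wt (p + q) (p + r) p (pre c)) α (wt p′ q′ r′ u) ⟨
  wt (p + q) (p + r) p (pre c) + α + wt p′ q′ r′ u
    ≡⟨ cong (_+ wt p′ q′ r′ u) (trans deficit (sym (wt-φ* p′ q′ r′ (pre i)))) ⟩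
  wt p′ q′ r′ (φ* (pre i)) + wt p′ q′ r′ u
    ≡⟨ trans (cong (wt p′ q′ r′) pre-n) (wt-++ p′ q′ r′ (φ* (pre i)) u) ⟨
  wt p′ q′ r′ (pre n) ∎
  where
  open ≡-Reasoning
  X = α + wt p′ q′ r′ u

pre-scale-+ : ∀ n w → At (scale n) w → pre (scale n + length w) ≡ φ* (pre n) ++ w
pre-scale-+ n w at = trans (pre-At (scale n) w at) (cong (_++ w) (pre-scale n))

step-represents : ∀ {s n} (p : Parent n) → s Represents Parent.index p → Exact s (Parent.before p) →
                  step s (Parent.before p , t n) Represents n
step-represents {s@(_ , α₀ , α₁ , α₂ , r)} {n} (parent i u v split position) rep
  (exact₀ , exact₁ , exact₂) =
  record
    { letter   = refl
    ; c        = m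
    ; window   = At-++ˡ _ (take 8 (drop (shift s u) (φ* r))) _
                   (subst (At _) (sym (take++drop≡id 8 _)) (At-++ʳ (scale c) d _ at-φ*r))
    ; deficit₀ = deficit-step 1 1 1 5 4 3 i n c m d u pre-m pre-n deficit₁ exact₀
    ; deficit₁ = deficit-step 2 2 1 9 8 5 i n c m d u pre-m pre-n deficit₂ exact₁
    ; deficit₂ = deficit-step 4 3 2 17 14 9 i n c m d u pre-m pre-n deficit₃ exact₂
    }
  where
  open _Represents_ rep
  d = skipped s u
  m = scale c + length d
  at-φ*r : At (scale c) (d ++ drop (shift s u) (φ* r))
  at-φ*r = subst (At (scale c)) (sym (take++drop≡id (shift s u) (φ* r))) (At-φ* c r window)
  pre-m : pre m ≡ φ* (pre c) ++ d
  pre-m = pre-scale-+ c d (At-++ˡ (scale c) d _ at-φ*r)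
  pre-n : pre n ≡ φ* (pre i) ++ u
  pre-n = trans (cong pre position)
    (pre-scale-+ i u (At-++ˡ (scale i) u _ (subst (At (scale i)) split (At-φ i))))
  -- (7,6,4) and (31,26,17) are (1,1,1)∘φ³ and (5,4,3)∘φ³. Each is the sum of the three preceding
  -- functionals in its chain, so the missing fourth deficit is the sum of the three known ones.
  deficit₃ : wt 7 6 4 (pre c) + (α₀ + α₁ + α₂) ≡ wt 31 26 17 (pre i)
  deficit₃ = begin
    wt 7 6 4 (pre c) + (α₀ + α₁ + α₂)
      ≡⟨ cong (_+ (α₀ + α₁ + α₂)) (trans (wt-+ 3 3 2 4 3 2 (pre c))
           (cong (_+ wt 4 3 2 (pre c)) (wt-+ 1 1 1 2 2 1 (pre c)))) ⟩
    wt 1 1 1 (pre c) + wt 2 2 1 (pre c) + wt 4 3 2 (pre c) + (α₀ + α₁ + α₂)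
      ≡⟨ regroup (wt 1 1 1 (pre c)) (wt 2 2 1 (pre c)) (wt 4 3 2 (pre c)) α₀ α₁ α₂ ⟩
    (wt 1 1 1 (pre c) + α₀) + (wt 2 2 1 (pre c) + α₁) + (wt 4 3 2 (pre c) + α₂)
      ≡⟨ cong₂ _+_ (cong₂ _+_ deficit₀ deficit₁) deficit₂ ⟩
    wt 5 4 3 (pre i) + wt 9 8 5 (pre i) + wt 17 14 9 (pre i)
      ≡⟨ trans (wt-+ 14 12 8 17 14 9 (pre i))
           (cong (_+ wt 17 14 9 (pre i)) (wt-+ 5 4 3 9 8 5 (pre i))) ⟨
    wt 31 26 17 (pre i) ∎
    where
    open ≡-Reasoning
    regroup : ∀ a b c x y z → a + b + c + (x + y + z) ≡ (a + x) + (b + y) + (c + z)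
    regroup = solve-∀

-- The alternatives 3 and 2 read off A n + B n and A n + B n ∸ 1 from the identities
-- (1,2,1) + (4,3,2) = (1,1,1) + 2(2,2,1) and (1,2,1) + (5,4,3) + (17,14,9) = (5,4,3) + 2(9,8,5).
Accepting : State → Set
Accepting (_ , α₀ , α₁ , α₂ , r) =
  length w ≡ α₀ + 2 ×
  (wt 1 2 1 w + α₂ ≡ 3 + (α₀ + 2 * α₁) ⊎ wt 1 2 1 w + α₂ ≡ 2 + (α₀ + 2 * α₁))
  where w = take (α₀ + 2) r

accepting? : ∀ s → Dec (Accepting s)
accepting? s = (_ ≟ _) ×-dec ((_ ≟ _) ⊎-dec (_ ≟ _))

initial : State
initial = l0 , 0 , 0 , 0 , l0 ∷ l1 ∷ l0 ∷ l2 ∷ l0 ∷ l1 ∷ l0 ∷ l0 ∷ []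

initial-represents : initial Represents 0
initial-represents = record
  { letter = refl ; c = 0 ; window = At-factor 0 8
  ; deficit₀ = refl ; deficit₁ = refl ; deficit₂ = refl }

reached : ℕ → List State
reached zero    = [ initial ]
reached (suc k) = deduplicate _≟ˢ_
  (reached k ++ concatMap (λ s → map (step s) (splits (φ (proj₁ s)))) (reached k))

-- No new state appears after nine rounds.
states : List State
states = reached 9

Closed : State → Set
Closed s = Accepting s ×
  All (λ (u , y) → Exact s u × step s (u , y) ∈ states) (splits (φ (proj₁ s)))

-- A finite check by evaluation: every state accepts, its transitions subtract exactly, and they
-- stay inside the list.
closed : All Closed states
closed = from-yes (all? (λ s → accepting? s ×-dec
  all? (λ (u , y) → exact? s u ×-dec (step s (u , y) ∈? states)) (splits (φ (proj₁ s)))) states)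

-- Strong induction along parents: the state of the parent index, advanced by `step`, represents
-- `n`.
representative : ∀ n → ∃ λ s → s ∈ states × s Represents n
representative = <-rec _ go
  where
  go : ∀ n → (∀ {i} → i < n → ∃ λ s → s ∈ states × s Represents i) →
       ∃ λ s → s ∈ states × s Represents n
  go zero    rec = initial , here refl , initial-represents
  go (suc n) rec with parentOf (suc n) | index< n (parentOf (suc n))
  ... | p | i<n with rec i<n
  ... | s , s∈ , rep = step s (u , t (suc n)) , proj₂ good , step-represents p rep (proj₁ good)
    where
    open Parent p using (split) renaming (before to u; after to v)
    u∈ : (u , t (suc n)) ∈ splits (φ (proj₁ s))
    u∈ = subst (λ w → (u , t (suc n)) ∈ splits w)
      (trans (sym split) (cong φ (_Represents_.letter rep))) (∈-splits u (t (suc n)) v)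
    good : Exact s u × step s (u , t (suc n)) ∈ states
    good = All.lookup (proj₂ (All.lookup closed s∈)) u∈

-- The argument is `B n` minus 1, because the sequences are indexed from 0: this is the term of `a`
-- at index `bₙ`.
A-at-B : ∀ n → A (2 + wt 5 4 3 (pre n)) ≡ A n + B n ⊎ A (2 + wt 5 4 3 (pre n)) ≡ A n + B n ∸ 1
A-at-B n with representative n
... | s@(x , α₀ , α₁ , α₂ , r) , s∈ , rep = conclude (proj₁ (All.lookup closed s∈))
  where
  open _Represents_ rep
  open ≡-Reasoning
  w = take (α₀ + 2) r
  U P : ℕ → ℕ → ℕ → ℕ
  U p q r = wt p q r (pre c)
  P p q r = wt p q r (pre n)

  U-relation : U 1 2 1 + U 4 3 2 ≡ U 1 1 1 + 2 * U 2 2 1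
  U-relation rewrite wt-basis 1 2 1 (pre c) | wt-basis 4 3 2 (pre c)
                     | wt-basis 1 1 1 (pre c) | wt-basis 2 2 1 (pre c) =
    lemma (wt 1 0 0 (pre c)) (wt 0 1 0 (pre c)) (wt 0 0 1 (pre c))
    where
    lemma : ∀ x y z → (1 * x + 2 * y + 1 * z) + (4 * x + 3 * y + 2 * z) ≡
                      (1 * x + 1 * y + 1 * z) + 2 * (2 * x + 2 * y + 1 * z)
    lemma = solve-∀

  P-relation : P 1 2 1 + P 5 4 3 + P 17 14 9 ≡ P 5 4 3 + 2 * P 9 8 5
  P-relation rewrite wt-basis 1 2 1 (pre n) | wt-basis 5 4 3 (pre n)
                     | wt-basis 17 14 9 (pre n) | wt-basis 9 8 5 (pre n) =
    lemma (wt 1 0 0 (pre n)) (wt 0 1 0 (pre n)) (wt 0 0 1 (pre n))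
    where
    lemma : ∀ x y z → (1 * x + 2 * y + 1 * z) + (5 * x + 4 * y + 3 * z) + (17 * x + 14 * y + 9 * z) ≡
                      (5 * x + 4 * y + 3 * z) + 2 * (9 * x + 8 * y + 5 * z)
    lemma = solve-∀

  -- The (1,1,1)-weight of `pre c` is `c` itself, so `deficit₀` says how far `c` lies to the left;
  -- `w` bridges this distance and the further 2.
  position : length w ≡ α₀ + 2 → 2 + P 5 4 3 ≡ c + length w
  position len = begin
    2 + P 5 4 3            ≡⟨ cong (2 +_) deficit₀ ⟨
    2 + (U 1 1 1 + α₀)     ≡⟨ cong (λ k → 2 + (k + α₀)) (trans (sym (length≡wt (pre c))) (length-pre c)) ⟩
    2 + (c + α₀)           ≡⟨ lemma c α₀ ⟩
    c + (α₀ + 2)           ≡⟨ cong (c +_) len ⟨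
    c + length w           ∎
    where
    lemma : ∀ c α → 2 + (c + α) ≡ c + (α + 2)
    lemma = solve-∀

  at-w : At c w
  at-w = At-++ˡ c w _ (subst (At c) (sym (take++drop≡id (α₀ + 2) r)) window)

  A-value : length w ≡ α₀ + 2 → A (2 + P 5 4 3) ≡ 1 + (U 1 2 1 + wt 1 2 1 w)
  A-value len = cong suc (begin
    wt 1 2 1 (pre (2 + P 5 4 3))   ≡⟨ cong (λ m → wt 1 2 1 (pre m)) (position len) ⟩
    wt 1 2 1 (pre (c + length w))  ≡⟨ cong (wt 1 2 1) (pre-At c w at-w) ⟩
    wt 1 2 1 (pre c ++ w)          ≡⟨ wt-++ 1 2 1 (pre c) w ⟩
    U 1 2 1 + wt 1 2 1 w           ∎)

  -- Adding the (17,14,9)-weight to both sides turns all deficits into sums. The result exceeds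
  -- `P 1 2 1 + P 5 4 3` by `k`; 3 matches the constants of `A n + B n`, and 2 falls one short.
  value : ∀ k → wt 1 2 1 w + α₂ ≡ k + (α₀ + 2 * α₁) → U 1 2 1 + wt 1 2 1 w ≡ k + (P 1 2 1 + P 5 4 3)
  value k eq = +-cancelʳ-≡ (P 17 14 9) _ _ (begin
    U 1 2 1 + wt 1 2 1 w + P 17 14 9             ≡⟨ cong (U 1 2 1 + wt 1 2 1 w +_) deficit₂ ⟨
    U 1 2 1 + wt 1 2 1 w + (U 4 3 2 + α₂)        ≡⟨ exchange (U 1 2 1) (wt 1 2 1 w) (U 4 3 2) α₂ ⟩
    (U 1 2 1 + U 4 3 2) + (wt 1 2 1 w + α₂)      ≡⟨ cong₂ _+_ U-relation eq ⟩
    (U 1 1 1 + 2 * U 2 2 1) + (k + (α₀ + 2 * α₁)) ≡⟨ collect (U 1 1 1) (U 2 2 1) k α₀ α₁ ⟩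
    k + ((U 1 1 1 + α₀) + 2 * (U 2 2 1 + α₁))    ≡⟨ cong₂ (λ a b → k + (a + 2 * b)) deficit₀ deficit₁ ⟩
    k + (P 5 4 3 + 2 * P 9 8 5)                  ≡⟨ cong (k +_) P-relation ⟨
    k + (P 1 2 1 + P 5 4 3 + P 17 14 9)          ≡⟨ +-assoc k _ _ ⟨
    k + (P 1 2 1 + P 5 4 3) + P 17 14 9          ∎)
    where
    exchange : ∀ a b c d → a + b + (c + d) ≡ (a + c) + (b + d)
    exchange = solve-∀
    collect : ∀ a b k x y → (a + 2 * b) + (k + (x + 2 * y)) ≡ k + ((a + x) + 2 * (b + y))
    collect = solve-∀

  regroup : ∀ p q → 1 + (3 + (p + q)) ≡ (1 + p) + (3 + q)
  regroup = solve-∀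

  regroup-∸1 : ∀ p q → 1 + (2 + (p + q)) ≡ (1 + p) + (3 + q) ∸ 1
  regroup-∸1 = lemma
    where
    lemma : ∀ p q → 1 + (2 + (p + q)) ≡ p + (3 + q)
    lemma = solve-∀

  conclude : Accepting s → A (2 + P 5 4 3) ≡ A n + B n ⊎ A (2 + P 5 4 3) ≡ A n + B n ∸ 1
  conclude (len , inj₁ eq) =
    inj₁ (trans (A-value len) (trans (cong suc (value 3 eq)) (regroup (P 1 2 1) (P 5 4 3))))
  conclude (len , inj₂ eq) =
    inj₂ (trans (A-value len) (trans (cong suc (value 2 eq)) (regroup-∸1 (P 1 2 1) (P 5 4 3))))

theorem3 : Σ (ℕ → ℕ) λ a → Σ (ℕ → ℕ) λ b → IsListing a b ×
    (∀ n → 1 ≤ n → a (b n) ≡ a n + b n ⊎ a (b n) ≡ (a n + b n) ∸ 1)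
theorem3 = (λ n → A (n ∸ 1)) , (λ n → B (n ∸ 1)) , listing , λ n _ → A-at-B (n ∸ 1)
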